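{- Let $\kappa$ be an infinite cardinal such that $\kappa^+$ is measurable. Then $\left(\begin{smallmatrix}\kappa^+\\ \kappa^+\\ \kappa^+\end{smallmatrix}\right)\rightarrow\left(\begin{smallmatrix}\kappa\\ \kappa\\ \kappa\end{smallmatrix}\right)_2$, and moreover $\left(\begin{smallmatrix}\kappa^+\\ \kappa^+\\ \kappa^+\end{smallmatrix}\right)\rightarrow\left(\begin{smallmatrix}\kappa\\ \kappa\\ \kappa^+\end{smallmatrix}\right)_2$.
   Context: The ambient theory is ZF (the axiom of choice is not assumed). $\kappa^+$ is measurable means there is a nonprincipal $\kappa^+$-complete ultrafilter on $\kappa^+$. The cube relation $\left(\begin{smallmatrix}\alpha\\ \beta\\ \gamma\end{smallmatrix}\right)\rightarrow\left(\begin{smallmatrix}\delta\\ \varepsilon\\ \zeta\end{smallmatrix}\right)_\theta$ means: for every coloring $c:\alpha\times\beta\times\gamma\rightarrow\theta$ there are $A\subseteq\alpha$, $B\subseteq\beta$, $C\subseteq\gamma$ with ${\rm otp}(A)=\delta$, ${\rm otp}(B)=\varepsilon$, ${\rm otp}(C)=\zeta$ such that $c\upharpoonright(A\times B\times C)$ is constant. -}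

module Defs where

open import Level using (Level) renaming (suc to lsuc)
open import Data.Nat.Base using (ℕ; suc)
open import Data.Fin.Base using (Fin)
open import Data.Vec.Base using (Vec; _∷_; lookup)
open import Data.Product.Base using (_×_)
open import Relation.Binary.PropositionalEquality.Core using (_≡_)
open import Relation.Nullary.Negation.Core using (¬_; Stable)

private
  variable
    ℓ ℓ′ : Level
    n : ℕ

-- ZF is a theory in classical logic, so ∨ and ∃ are the classical connectives,
-- defined from ¬, ∧ and ∀.  In particular a proof of ∀ x ∃ y … carries no choice
-- function, and no excluded middle is needed in the metatheory.

infixr 1 _∨_
infix  0 _↔_

_∨_ : Set ℓ → Set ℓ′ → Set _
A ∨ B = ¬ (¬ A × ¬ B)

_↔_ : Set ℓ → Set ℓ′ → Set _
A ↔ B = (A → B) × (B → A)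

∃ : {A : Set ℓ} → (A → Set ℓ′) → Set _
∃ P = ¬ (∀ x → ¬ P x)

infix 0 ∃-syntax

∃-syntax : {A : Set ℓ} → (A → Set ℓ′) → Set _
∃-syntax = ∃

syntax ∃-syntax (λ x → P) = ∃[ x ] P

-- First-order formulas of the language {∈, =} with free variables in Fin n (de
-- Bruijn indices).  The schemas below range over these, and not over arbitrary
-- predicates V → Set, which would give second-order ZF.

data Formula (n : ℕ) : Set where
  _∈̇_ _≐_ : (i j : Fin n) → Formula n
  ¬̇_      : Formula n → Formula n
  _∧̇_ _⇒̇_ : (φ ψ : Formula n) → Formula n
  ∀̇_      : Formula (suc n) → Formula n

module Satisfaction {V : Set ℓ} (_∈_ : V → V → Set ℓ) where

  ⟦_⟧ : Formula n → Vec V n → Set ℓ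
  ⟦ i ∈̇ j ⟧ ρ = lookup ρ i ∈ lookup ρ j
  ⟦ i ≐ j ⟧ ρ = lookup ρ i ≡ lookup ρ j
  ⟦ ¬̇ φ   ⟧ ρ = ¬ ⟦ φ ⟧ ρ
  ⟦ φ ∧̇ ψ ⟧ ρ = ⟦ φ ⟧ ρ × ⟦ ψ ⟧ ρ
  ⟦ φ ⇒̇ ψ ⟧ ρ = ⟦ φ ⟧ ρ → ⟦ ψ ⟧ ρ
  ⟦ ∀̇ φ   ⟧ ρ = ∀ x → ⟦ φ ⟧ (x ∷ ρ)

module Notions {V : Set ℓ} (_∈_ : V → V → Set ℓ) where

  infix 4 _⊆_

  _⊆_ : V → V → Set ℓ
  x ⊆ y = ∀ z → z ∈ x → z ∈ y

  IsEmpty : V → Set ℓ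
  IsEmpty x = ∀ z → ¬ (z ∈ x)

  Nonempty : V → Set ℓ
  Nonempty x = ∃[ z ] z ∈ x

  -- s = x ∪ {x}
  IsSuccessor : V → V → Set ℓ
  IsSuccessor s x = ∀ z → z ∈ s ↔ (z ∈ x ∨ z ≡ x)

  Inductive : V → Set ℓ
  Inductive I = (∃[ e ] IsEmpty e × e ∈ I)
              × (∀ x → x ∈ I → ∃[ s ] IsSuccessor s x × s ∈ I)

  -- p = {x , y}
  IsUnorderedPair : V → V → V → Set ℓ
  IsUnorderedPair p x y = ∀ z → z ∈ p ↔ (z ≡ x ∨ z ≡ y)

  -- p = (x , y) = {{x} , {x , y}}
  IsPair : V → V → V → Set ℓ
  IsPair p x y = ∃[ s ] ∃[ d ]
    IsUnorderedPair s x x × IsUnorderedPair d x y × IsUnorderedPair p s d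

  -- P = A × B
  IsProduct : V → V → V → Set ℓ
  IsProduct P A B =
    ∀ p → p ∈ P ↔ (∃[ x ] ∃[ y ] x ∈ A × y ∈ B × IsPair p x y)

  -- (x , y) ∈ f, i.e. f(x) = y when f is a function
  Maps : V → V → V → Set ℓ
  Maps f x y = ∃[ p ] IsPair p x y × p ∈ f

  -- f : A → B
  IsFunction : V → V → V → Set ℓ
  IsFunction f A B =
      (∀ p → p ∈ f → ∃[ x ] ∃[ y ] x ∈ A × y ∈ B × IsPair p x y)
    × (∀ x → x ∈ A → ∃[ y ] Maps f x y)
    × (∀ x y y′ → Maps f x y → Maps f x y′ → y ≡ y′)

  IsBijection : V → V → V → Set ℓ
  IsBijection f A B =
      IsFunction f A B
    × (∀ x x′ y → Maps f x y → Maps f x′ y → x ≡ x′)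
    × (∀ y → y ∈ B → ∃[ x ] Maps f x y)

  Equinumerous : V → V → Set ℓ
  Equinumerous A B = ∃[ f ] IsBijection f A B

  Transitive : V → Set ℓ
  Transitive x = ∀ y → y ∈ x → y ⊆ x

  WellOrderedBy∈ : V → Set ℓ
  WellOrderedBy∈ A =
      (∀ x → x ∈ A → ¬ (x ∈ x))
    × (∀ x y z → x ∈ A → y ∈ A → z ∈ A → x ∈ y → y ∈ z → x ∈ z)
    × (∀ x y → x ∈ A → y ∈ A → x ∈ y ∨ x ≡ y ∨ y ∈ x)
    × (∀ S → S ⊆ A → Nonempty S →
         ∃[ m ] m ∈ S × (∀ x → x ∈ S → m ≡ x ∨ m ∈ x))

  Ordinal : V → Set ℓ
  Ordinal α = Transitive α × WellOrderedBy∈ α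

  -- otp(A) = δ, for a set of ordinals A
  HasOrderType : V → V → Set ℓ
  HasOrderType A δ = Ordinal δ × (∃[ f ]
      IsBijection f A δ
    × (∀ x x′ y y′ → Maps f x y → Maps f x′ y′ → x ∈ x′ ↔ y ∈ y′))

  Natural : V → Set ℓ
  Natural k = ∀ I → Inductive I → k ∈ I

  Finite : V → Set ℓ
  Finite x = ∃[ k ] Natural k × Equinumerous x k

  -- Cardinals are initial ordinals (alephs, when infinite).
  Cardinal : V → Set ℓ
  Cardinal κ = Ordinal κ × (∀ α → α ∈ κ → ¬ Equinumerous κ α)

  InfiniteCardinal : V → Set ℓ
  InfiniteCardinal κ = Cardinal κ × ¬ Finite κ

  -- μ = κ⁺, the least cardinal above κ
  IsSuccessorCardinal : V → V → Set ℓ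
  IsSuccessorCardinal μ κ =
      Cardinal μ × κ ∈ μ
    × (∀ ν → Cardinal ν → κ ∈ ν → μ ≡ ν ∨ μ ∈ ν)

  IsUltrafilterOn : V → V → Set ℓ
  IsUltrafilterOn U X =
      (∀ A → A ∈ U → A ⊆ X)
    × X ∈ U
    × (∀ A → IsEmpty A → ¬ (A ∈ U))
    × (∀ A B → A ∈ U → A ⊆ B → B ⊆ X → B ∈ U)
    × (∀ A B D → A ∈ U → B ∈ U → (∀ z → z ∈ D ↔ (z ∈ A × z ∈ B)) → D ∈ U)
    × (∀ A D → A ⊆ X → (∀ z → z ∈ D ↔ (z ∈ X × ¬ (z ∈ A))) → A ∈ U ∨ D ∈ U)

  IsPrincipalOn : V → V → Set ℓ
  IsPrincipalOn U X = ∃[ a ] a ∈ X × (∀ A → A ∈ U ↔ (A ⊆ X × a ∈ A))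

  -- μ-completeness: if β < μ and A_ξ ∈ U for ξ < β, then ⋂_{ξ<β} A_ξ ∈ U, where
  -- the intersection is taken within X (so it is X for β = 0).
  IsCompleteOn : V → V → V → Set ℓ
  IsCompleteOn μ U X =
    ∀ β f D → β ∈ μ → IsFunction f β U →
    (∀ z → z ∈ D ↔ (z ∈ X × (∀ ξ A → Maps f ξ A → z ∈ A))) →
    D ∈ U

  Measurable : V → Set ℓ
  Measurable μ = ∃[ U ]
    IsUltrafilterOn U μ × ¬ IsPrincipalOn U μ × IsCompleteOn μ U μ

  -- 2 = {0 , 1} = {∅ , {∅}}
  IsTwo : V → Set ℓ
  IsTwo t = ∃[ o ] ∃[ i ] IsEmpty o × IsSuccessor i o × IsUnorderedPair t o i

  -- c(x , y , z) = i, with (x , y , z) = ((x , y) , z)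
  MapsTriple : V → V → V → V → V → Set ℓ
  MapsTriple c x y z i = ∃[ q ] ∃[ t ] IsPair q x y × IsPair t q z × Maps c t i

  -- c : α × β × γ → θ
  IsColoring : V → V → V → V → V → Set ℓ
  IsColoring c α β γ θ = ∃[ P ] ∃[ Q ]
    IsProduct P α β × IsProduct Q P γ × IsFunction c Q θ

  ConstantOn : V → V → V → V → V → Set ℓ
  ConstantOn c A B C θ = ∃[ i ] i ∈ θ
    × (∀ x y z → x ∈ A → y ∈ B → z ∈ C → MapsTriple c x y z i)

  -- The cube relation (α β γ) → (δ ε ζ)_θ.
  Cube : (α β γ δ ε ζ θ : V) → Set ℓ
  Cube α β γ δ ε ζ θ =
    ∀ c → IsColoring c α β γ θ →
    ∃[ A ] ∃[ B ] ∃[ C ]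
        A ⊆ α × B ⊆ β × C ⊆ γ
      × HasOrderType A δ × HasOrderType B ε × HasOrderType C ζ
      × ConstantOn c A B C θ

-- Models of ZF, with = interpreted as equality.  Stability of ∈ (and hence, by
-- extensionality, of =) makes every formula stable, so that the structure
-- validates classical logic.

record ZF (ℓ : Level) : Set (lsuc ℓ) where
  infix 4 _∈_
  field
    V        : Set ℓ
    _∈_      : V → V → Set ℓ
    ∈-stable : ∀ x y → Stable (x ∈ y)

  open Satisfaction _∈_ public
  open Notions _∈_ public

  field
    extensionality : ∀ x y → (∀ z → z ∈ x ↔ z ∈ y) → x ≡ y
    foundation     : ∀ x → Nonempty x → ∃[ y ] y ∈ x × (∀ z → z ∈ x → ¬ (z ∈ y))
    pairing        : ∀ x y → ∃[ p ] IsUnorderedPair p x y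
    union          : ∀ x → ∃[ u ] ∀ z → z ∈ u ↔ (∃[ y ] y ∈ x × z ∈ y)
    powerset       : ∀ x → ∃[ p ] ∀ z → z ∈ p ↔ z ⊆ x
    infinity       : ∃[ I ] Inductive I
    separation     : ∀ {n} (φ : Formula (suc n)) (ρ : Vec V n) x →
                     ∃[ y ] ∀ z → z ∈ y ↔ (z ∈ x × ⟦ φ ⟧ (z ∷ ρ))
    replacement    : ∀ {n} (φ : Formula (suc (suc n))) (ρ : Vec V n) x →
                     (∀ u v v′ → u ∈ x →
                       ⟦ φ ⟧ (u ∷ v ∷ ρ) → ⟦ φ ⟧ (u ∷ v′ ∷ ρ) → v ≡ v′) →
                     ∃[ y ] ∀ v → v ∈ y ↔ (∃[ u ] u ∈ x × ⟦ φ ⟧ (u ∷ v ∷ ρ))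

{-# OPTIONS --safe #-}

-- Let U be a nonprincipal κ⁺-complete ultrafilter on κ⁺.  Write ∀ᵁ for "for U-many".
-- Since U is an ultrafilter, some colour i satisfies ∀ᵁ x ∀ᵁ y ∀ᵁ z c(x,y,z) = i.
-- Members of U have order type κ⁺, so there is A of order type κ with
-- ∀ᵁ y ∀ᵁ z c(x,y,z) = i for all x ∈ A; by completeness, ∀ᵁ y works for all x ∈ A at
-- once, and we pick B of order type κ among these y.  Completeness, applied over B
-- and then over A, shows that U-many z satisfy c(x,y,z) = i for all (x,y) ∈ A × B.
--
-- That A ∈ U has order type κ⁺ is seen by comparison: the union of all
-- isomorphisms between initial segments of A and of κ⁺ is total on A, and its
-- range is not an ordinal β < κ⁺, for otherwise A would be a union of β null
-- singletons.

module Submission where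

open import Level using (Level)
open import Data.Nat.Base using (ℕ; suc; _+_)
open import Data.Fin.Base using (Fin; zero; suc)
open import Data.Vec.Base using (Vec; []; _∷_)
open import Data.Product.Base using (_×_; _,_; proj₁; proj₂)
open import Data.Empty using (⊥; ⊥-elim)
open import Function.Base using (id)
open import Relation.Binary.PropositionalEquality using (_≡_; refl; sym; trans; subst)
open import Relation.Nullary.Negation.Core using (¬_; Stable)
open import Defs

private
  variable
    n : ℕ

-- Formulas of set theory in de Bruijn form.

pattern v0 = zero
pattern v1 = suc v0
pattern v2 = suc v1
pattern v3 = suc v2
pattern v4 = suc v3
pattern v5 = suc v4
pattern v6 = suc v5
pattern v7 = suc v6
pattern v8 = suc v7
pattern v9 = suc v8
pattern v10 = suc v9
pattern v11 = suc v10

infixr 3 _∧̇′_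
infixr 2 _⇒̇′_
infix  1 _⇔̇_

-- The primed connectives are the constructors with right-associative fixities, so that long
-- conjunctions nest as the semantic ones do.
_∧̇′_ _⇒̇′_ _∨̇_ _⇔̇_ : Formula n → Formula n → Formula n
φ ∧̇′ ψ = φ ∧̇ ψ
φ ⇒̇′ ψ = φ ⇒̇ ψ
φ ∨̇ ψ = ¬̇ ((¬̇ φ) ∧̇ (¬̇ ψ))
φ ⇔̇ ψ = (φ ⇒̇ ψ) ∧̇ (ψ ⇒̇ φ)

∃̇_ : Formula (suc n) → Formula n
∃̇ φ = ¬̇ (∀̇ (¬̇ φ))

-- Satisfaction of a formula with a dotted name unfolds definitionally to the
-- corresponding semantic notion, so instances of the schemas need no translation.

unorderedPaiṙ paiṙ mapṡ : (i j k : Fin n) → Formula n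
unorderedPaiṙ p x y = ∀̇ ((v0 ∈̇ suc p) ⇔̇ ((v0 ≐ suc x) ∨̇ (v0 ≐ suc y)))
paiṙ p x y = ∃̇ (∃̇ (unorderedPaiṙ v1 (suc (suc x)) (suc (suc x))
  ∧̇′ unorderedPaiṙ v0 (suc (suc x)) (suc (suc y))
  ∧̇′ unorderedPaiṙ (suc (suc p)) v1 v0))
mapṡ f x y = ∃̇ (paiṙ v0 (suc x) (suc y) ∧̇ (v0 ∈̇ suc f))

mapsTriplė : (c x y z i : Fin n) → Formula n
mapsTriplė c x y z i = ∃̇ (∃̇ (paiṙ v1 (suc (suc x)) (suc (suc y))
  ∧̇′ paiṙ v0 v1 (suc (suc z)) ∧̇′ mapṡ (suc (suc c)) v0 (suc (suc i))))

module SetTheory {ℓ : Level} (M : ZF ℓ) where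
  open ZF M

  -- Stability, minimal elements and ∈-induction.

  private
    variable
      a b f p q s u v x y z x′ y′ : V

  ≡-stable : Stable (x ≡ y)
  ≡-stable h = extensionality _ _ λ z →
    (λ z∈x → ∈-stable _ _ λ z∉y → h λ { refl → z∉y z∈x }) ,
    (λ z∈y → ∈-stable _ _ λ z∉x → h λ { refl → z∉x z∈y })

  -- Stability passes up from the atoms, since no primitive connective is a disjunction or an
  -- existential. Goals given by formulas can therefore be proved by contradiction.
  ⟦⟧-stable : (φ : Formula n) (ρ : Vec V n) → Stable (⟦ φ ⟧ ρ)
  ⟦⟧-stable (i ∈̇ j) ρ   = ∈-stable _ _
  ⟦⟧-stable (i ≐ j) ρ   = ≡-stable
  ⟦⟧-stable (¬̇ φ)   ρ h = λ k → h λ g → g k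
  ⟦⟧-stable (φ ∧̇ ψ) ρ h = ⟦⟧-stable φ ρ (λ k → h λ g → k (proj₁ g)) ,
                          ⟦⟧-stable ψ ρ (λ k → h λ g → k (proj₂ g))
  ⟦⟧-stable (φ ⇒̇ ψ) ρ h = λ g → ⟦⟧-stable ψ ρ λ k → h λ e → k (e g)
  ⟦⟧-stable (∀̇ φ)   ρ h = λ x → ⟦⟧-stable φ (x ∷ ρ) λ k → h λ e → k (e x)

  -- Foundation, applied to the set of witnesses in `X`. As `∃` is `¬ ∀ ¬`, an existential fact is
  -- used, here and below, by passing it a continuation into `⊥`; `k` is the refutation of the goal.
  ∈-least : (φ : Formula (suc n)) (ρ : Vec V n) (X : V) →
            ∃[ u ] u ∈ X × ⟦ φ ⟧ (u ∷ ρ) →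
            ∃[ u ] u ∈ X × ⟦ φ ⟧ (u ∷ ρ) × (∀ w → w ∈ X → w ∈ u → ¬ ⟦ φ ⟧ (w ∷ ρ))
  ∈-least φ ρ X e k =
    e λ u (u∈X , φu) →
    separation φ ρ X λ S S-def →
    foundation S (λ empty → empty u (proj₂ (S-def u) (u∈X , φu))) λ m (m∈S , least) →
    k m ( proj₁ (proj₁ (S-def m) m∈S) , proj₂ (proj₁ (S-def m) m∈S)
        , λ w w∈X w∈m φw → least w (proj₂ (S-def w) (w∈X , φw)) w∈m)

  -- A counterexample yields an ∈-minimal one. Its elements lie in `X` by transitivity, so by
  -- minimality they satisfy `φ`.
  ∈-induction : (φ : Formula (suc n)) (ρ : Vec V n) (X : V) → Transitive X →
                (∀ u → u ∈ X → (∀ w → w ∈ u → ⟦ φ ⟧ (w ∷ ρ)) → ⟦ φ ⟧ (u ∷ ρ)) →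
                ∀ u → u ∈ X → ⟦ φ ⟧ (u ∷ ρ)
  ∈-induction φ ρ X tr step u u∈X = ⟦⟧-stable φ _ λ ¬φu →
    ∈-least (¬̇ φ) ρ X (λ k → k u (u∈X , ¬φu)) λ m (m∈X , ¬φm , least) →
    ¬φm (step m m∈X λ w w∈m → ⟦⟧-stable φ _ (least w (tr m m∈X w w∈m) w∈m))

  -- Ordered pairs

  left∈ : IsUnorderedPair p x y → x ∈ p
  left∈ up = proj₂ (up _) λ k → proj₁ k refl

  right∈ : IsUnorderedPair p x y → y ∈ p
  right∈ up = proj₂ (up _) λ k → proj₂ k refl

  ∈singleton : IsUnorderedPair s x x → z ∈ s → z ≡ x
  ∈singleton up z∈s = ≡-stable λ z≢x → proj₁ (up _) z∈s (z≢x , z≢x)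

  unorderedPair-unique : IsUnorderedPair p x y → IsUnorderedPair q x y → p ≡ q
  unorderedPair-unique P Q = extensionality _ _ λ z →
    (λ z∈p → proj₂ (Q z) (proj₁ (P z) z∈p)) , (λ z∈q → proj₂ (P z) (proj₁ (Q z) z∈q))

  pair-exists : ∀ x y → ∃[ p ] IsPair p x y
  pair-exists x y k =
    pairing x x λ s S →
    pairing x y λ d D →
    pairing s d λ p P →
    k p λ j → j s λ l → l d (S , D , P)

  pair-unique : IsPair p x y → IsPair q x y → p ≡ q
  pair-unique P Q = ≡-stable λ p≢q →
    P λ s P₁ → P₁ λ d (S , D , SD) →
    Q λ s′ Q₁ → Q₁ λ d′ (S′ , D′ , SD′) →
    lemma p≢q (unorderedPair-unique S S′) (unorderedPair-unique D D′) SD SD′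
    where
    lemma : ∀ {s s′ d d′ p q} → ¬ p ≡ q → s ≡ s′ → d ≡ d′ →
            IsUnorderedPair p s d → IsUnorderedPair q s′ d′ → ⊥
    lemma p≢q refl refl SD SD′ = p≢q (unorderedPair-unique SD SD′)

  pair-injective₁ : IsPair p x y → IsPair p x′ y′ → x ≡ x′
  pair-injective₁ P Q = ≡-stable λ x≢x′ →
    P λ s P₁ → P₁ λ d (S , D , SD) →
    Q λ s′ Q₁ → Q₁ λ d′ (S′ , D′ , SD′) →
    proj₁ (SD′ s) (left∈ SD)
      ( (λ { refl → x≢x′ (∈singleton S′ (left∈ S)) })
      , (λ { refl → x≢x′ (sym (∈singleton S (left∈ D′))) }))

  pair-second : IsPair p x y → IsPair p x′ y′ → y ≡ x′ ∨ y ≡ y′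
  pair-second P Q (y≢x′ , y≢y′) =
    P λ s P₁ → P₁ λ d (S , D , SD) →
    Q λ s′ Q₁ → Q₁ λ d′ (S′ , D′ , SD′) →
    proj₁ (SD′ d) (right∈ SD)
      ( (λ { refl → y≢x′ (∈singleton S′ (right∈ D)) })
      , (λ { refl → proj₁ (D′ _) (right∈ D) (y≢x′ , y≢y′) }))

  -- `pair-second` in both directions leaves only the case `y ≡ x′`, `y′ ≡ x`, which equality of the
  -- first coordinates settles.
  pair-injective₂ : IsPair p x y → IsPair p x′ y′ → y ≡ y′
  pair-injective₂ P Q = ≡-stable λ y≢y′ →
    pair-second P Q
      ( (λ y≡x′ → pair-second Q P
          ( (λ y′≡x → y≢y′ (trans y≡x′ (trans (sym (pair-injective₁ P Q)) (sym y′≡x))))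
          , (λ y′≡y → y≢y′ (sym y′≡y))))
      , y≢y′)

  maps⇒∈ : Maps f x y → IsPair p x y → p ∈ f
  maps⇒∈ m P = ∈-stable _ _ λ p∉f →
    m λ q (Q , q∈f) → p∉f (subst (_∈ _) (pair-unique Q P) q∈f)

  maps-source : IsFunction f a b → Maps f x y → x ∈ a
  maps-source F m = ∈-stable _ _ λ x∉a →
    m λ p (P , p∈f) → proj₁ F p p∈f λ x′ e → e λ y′ (x′∈a , _ , P′) →
    x∉a (subst (_∈ _) (pair-injective₁ P′ P) x′∈a)

  maps-target : IsFunction f a b → Maps f x y → y ∈ b
  maps-target F m = ∈-stable _ _ λ y∉b →
    m λ p (P , p∈f) → proj₁ F p p∈f λ x′ e → e λ y′ (_ , y′∈b , P′) →
    y∉b (subst (_∈ _) (pair-injective₂ P′ P) y′∈b)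

  -- Order types of subsets of an ordinal

  OrderPreserving : V → Set ℓ
  OrderPreserving f = ∀ x x′ y y′ → Maps f x y → Maps f x′ y′ → x ∈ x′ ↔ y ∈ y′

  module _ (μ P : V) (ord : Ordinal μ) (prod : IsProduct P μ μ) where

    μ-transitive : Transitive μ
    μ-transitive = proj₁ ord

    irreflexive : x ∈ μ → ¬ x ∈ x
    irreflexive = proj₁ (proj₂ ord) _

    asymmetric : x ∈ μ → y ∈ μ → x ∈ y → ¬ y ∈ x
    asymmetric x∈μ y∈μ x∈y y∈x =
      irreflexive x∈μ (proj₁ (proj₂ (proj₂ ord)) _ _ _ x∈μ y∈μ x∈μ x∈y y∈x)

    trichotomy : x ∈ μ → y ∈ μ → ¬ x ∈ y → ¬ x ≡ y → ¬ y ∈ x → ⊥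
    trichotomy x∈μ y∈μ x∉y x≢y y∉x =
      proj₁ (proj₂ (proj₂ (proj₂ ord))) _ _ x∈μ y∈μ (x∉y , λ k → k (x≢y , y∉x))

    IsRelation : V → Set ℓ
    IsRelation T = ∀ p → p ∈ T → ∃[ x ] ∃[ y ] IsPair p x y

    -- Separation from `P`, the square of μ. The equivalence is asked for every `p`, so the truth of
    -- `φ` depends on the coordinates alone.
    relation : (φ : Formula (3 + n)) (ρ : Vec V n) (Ψ : V → V → Set ℓ) →
               (∀ y x p → ⟦ φ ⟧ (y ∷ x ∷ p ∷ ρ) ↔ Ψ x y) →
               ∃[ T ] IsRelation T × (∀ x y → Maps T x y ↔ (x ∈ μ × y ∈ μ × Ψ x y))
    relation φ ρ Ψ φ⇔Ψ k =
      separation (∃̇ (∃̇ (paiṙ v2 v1 v0 ∧̇ φ))) ρ P λ T T-def →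
      k T
        ( (λ p p∈T j → proj₂ (proj₁ (T-def p) p∈T) λ x e → e λ y (pr , _) →
             j x λ l → l y pr)
        , λ x y →
            (λ m → maps∈μ₁ T T-def m , maps∈μ₂ T T-def m , mapsΨ T T-def m)
          , (λ (x∈μ , y∈μ , ψ) j → pair-exists x y λ p pr →
               j p (pr , proj₂ (T-def p)
                 ( proj₂ (prod p) (λ l → l x λ l′ → l′ y (x∈μ , y∈μ , pr))
                 , λ l → l x λ l′ → l′ y (pr , proj₂ (φ⇔Ψ y x p) ψ)))))
      where
      Def : V → Set ℓ
      Def T = ∀ p → p ∈ T ↔ (p ∈ P × (∃[ x ] ∃[ y ] IsPair p x y × ⟦ φ ⟧ (y ∷ x ∷ p ∷ ρ)))

      maps∈μ₁ : ∀ T → Def T → Maps T x y → x ∈ μ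
      maps∈μ₁ T T-def m = ∈-stable _ _ λ no → m λ p (pr , p∈T) →
        proj₁ (prod p) (proj₁ (proj₁ (T-def p) p∈T)) λ x′ e → e λ y′ (x′∈μ , _ , pr′) →
        no (subst (_∈ μ) (pair-injective₁ pr′ pr) x′∈μ)

      maps∈μ₂ : ∀ T → Def T → Maps T x y → y ∈ μ
      maps∈μ₂ T T-def m = ∈-stable _ _ λ no → m λ p (pr , p∈T) →
        proj₁ (prod p) (proj₁ (proj₁ (T-def p) p∈T)) λ x′ e → e λ y′ (_ , y′∈μ , pr′) →
        no (subst (_∈ μ) (pair-injective₂ pr′ pr) y′∈μ)

      mapsΨ : ∀ T → Def T → Maps T x y → Ψ x y
      -- `x` fills the slot of the pair, where `φ⇔Ψ` admits any set.
      mapsΨ {x} {y} T T-def m = proj₁ (φ⇔Ψ y x x) (⟦⟧-stable φ _ λ no →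
        m λ p (pr , p∈T) →
        proj₂ (proj₁ (T-def p) p∈T) λ x′ e → e λ y′ (pr′ , φ′) →
        no (proj₂ (φ⇔Ψ y x x)
             (transport (pair-injective₁ pr′ pr) (pair-injective₂ pr′ pr) (proj₁ (φ⇔Ψ y′ x′ p) φ′))))
        where
        transport : ∀ {x′ y′} → x′ ≡ x → y′ ≡ y → Ψ x′ y′ → Ψ x y
        transport refl refl ψ = ψ

    -- Partial isomorphisms between a subset of μ and μ.

    module _ (A : V) (A⊆μ : A ⊆ μ) where

      -- h is an isomorphism from an initial segment of A onto an initial segment of μ.
      PartialIso : V → Set ℓ
      PartialIso h =
          (∀ u v → Maps h u v → u ∈ A × v ∈ μ)
        × OrderPreserving h
        × (∀ u v → Maps h u v → ∀ u′ → u′ ∈ A → u′ ∈ u → ∃[ v′ ] Maps h u′ v′)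
        × (∀ u v → Maps h u v → ∀ v′ → v′ ∈ v → ∃[ u′ ] Maps h u′ v′)

      -- Needed as a formula because `greatest-partialIso` quantifies over partial isomorphisms
      -- inside an instance of separation.
      partialIsȯ : (h A μ : Fin n) → Formula n
      partialIsȯ h A μ =
           (∀̇ (∀̇ (mapṡ (suc (suc h)) v1 v0
             ⇒̇′ (v1 ∈̇ suc (suc A)) ∧̇′ (v0 ∈̇ suc (suc μ)))))
        ∧̇′ (∀̇ (∀̇ (∀̇ (∀̇ (mapṡ (suc (suc (suc (suc h)))) v3 v1
             ⇒̇′ mapṡ (suc (suc (suc (suc h)))) v2 v0
             ⇒̇′ ((v3 ∈̇ v2) ⇔̇ (v1 ∈̇ v0)))))))
        ∧̇′ (∀̇ (∀̇ (mapṡ (suc (suc h)) v1 v0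
             ⇒̇′ (∀̇ ((v0 ∈̇ suc (suc (suc A))) ⇒̇′ (v0 ∈̇ v2)
             ⇒̇′ (∃̇ mapṡ (suc (suc (suc (suc h)))) v1 v0))))))
        ∧̇′ (∀̇ (∀̇ (mapṡ (suc (suc h)) v1 v0
             ⇒̇′ (∀̇ ((v0 ∈̇ v1)
             ⇒̇′ (∃̇ mapṡ (suc (suc (suc (suc h)))) v0 v1))))))

      module _ {h} (iso : PartialIso h) where
        source : Maps h u v → u ∈ A
        source m = proj₁ (proj₁ iso _ _ m)

        source∈μ : Maps h u v → u ∈ μ
        source∈μ m = A⊆μ _ (source m)

        target : Maps h u v → v ∈ μ
        target m = proj₂ (proj₁ iso _ _ m)

        order : OrderPreserving h
        order = proj₁ (proj₂ iso)

        down : Maps h u v → x ∈ A → x ∈ u → ∃[ y ] Maps h x y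
        down m = proj₁ (proj₂ (proj₂ iso)) _ _ m _

        down′ : Maps h u v → y ∈ v → ∃[ x ] Maps h x y
        down′ m = proj₂ (proj₂ (proj₂ iso)) _ _ m _

        -- If `u` lies below its value, then `u` is itself the value at some `w`. Order preservation
        -- puts `w` below `u`, so `w` is a smaller ascent.
        no-ascent : ∀ u → u ∈ μ → ∀ v → Maps h u v → ¬ u ∈ v
        no-ascent = ∈-induction (∀̇ (mapṡ v2 v1 v0 ⇒̇ (¬̇ (v1 ∈̇ v0)))) (h ∷ []) μ μ-transitive
          λ u _ ih v m u∈v → down′ m u∈v λ w m′ →
          let w∈u = proj₂ (order _ _ _ _ m′ m) u∈v in ih w w∈u u m′ w∈u

      Agree : V → V → V → Set ℓ
      Agree h k u = ∀ v v′ → Maps h u v → Maps k u v′ → v ≡ v′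

      -- Induction on `u`: an element of the value of `h` at `u` is a value of `h` at some `x ∈ u`,
      -- hence also of `k` at `x`, hence lies in the value of `k` at `u`.
      agree : ∀ {h k} → PartialIso h → PartialIso k → ∀ u → u ∈ μ → Agree h k u
      agree {h} {k} H K =
        ∈-induction (∀̇ (∀̇ (mapṡ v3 v2 v1 ⇒̇ (mapṡ v4 v2 v0 ⇒̇ (v1 ≐ v0))))) (h ∷ k ∷ []) μ
          μ-transitive
          λ u _ ih v v′ m m′ → extensionality _ _ λ w →
            value⊆ H K ih m m′
          , value⊆ K H (λ w w∈u x x′ n n′ → sym (ih w w∈u x′ x n′ n)) m′ m
        where
        value⊆ : ∀ {h k u v v′ w} → PartialIso h → PartialIso k →
                 (∀ w → w ∈ u → Agree h k w) →
                 Maps h u v → Maps k u v′ → w ∈ v → w ∈ v′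
        value⊆ H K ih m m′ w∈v = ∈-stable _ _ λ no →
          down′ H m w∈v λ x n →
          let x∈u = proj₂ (order H _ _ _ _ n m) w∈v in
          down K m′ (source H n) x∈u λ w′ n′ →
          no (subst (_∈ _) (sym (ih x x∈u _ _ n n′)) (proj₁ (order K _ _ _ _ n′ m′) x∈u))

      -- Were `u` below `v`, then `k` would also be defined at `u`, with value `y` by `agree` but
      -- strictly below its value `y` at `v`.
      agree⁻¹ : ∀ {h k} → PartialIso h → PartialIso k → Maps h u y → Maps k v y → u ≡ v
      agree⁻¹ H K m m′ = ≡-stable λ u≢v →
        trichotomy (source∈μ H m) (source∈μ K m′)
          (λ u∈v → down K m′ (source H m) u∈v λ w n →
             irreflexive (target H m)
               (subst (_∈ _) (sym (agree H K _ (source∈μ H m) _ _ m n))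
                 (proj₁ (order K _ _ _ _ n m′) u∈v)))
          u≢v
          (λ v∈u → down H m (source K m′) v∈u λ w n →
             irreflexive (target H m)
               (subst (_∈ _) (agree H K _ (source∈μ K m′) _ _ n m′)
                 (proj₁ (order H _ _ _ _ n m) v∈u)))

      -- Both directions reduce to `k` alone: its domain and range are initial, so it also contains
      -- the pair `(x , y)` once either coordinate is the smaller one.
      order₂ : ∀ {h k} → PartialIso h → PartialIso k →
               Maps h x y → Maps k x′ y′ → x ∈ x′ ↔ y ∈ y′
      order₂ H K m m′ =
          (λ x∈x′ → ∈-stable _ _ λ no → down K m′ (source H m) x∈x′ λ w n →
             no (subst (_∈ _) (sym (agree H K _ (source∈μ H m) _ _ m n))
                  (proj₁ (order K _ _ _ _ n m′) x∈x′)))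
        , (λ y∈y′ → ∈-stable _ _ λ no → down′ K m′ y∈y′ λ w n →
             no (subst (_∈ _) (sym (agree⁻¹ H K m n)) (proj₂ (order K _ _ _ _ n m′) y∈y′)))

      -- The union of all partial isomorphisms, whose compatibility is `order₂`.
      greatest-partialIso : ∃[ T ] PartialIso T
                          × (∀ h → PartialIso h → ∀ u v → Maps h u v → Maps T u v)
      greatest-partialIso k =
        relation (∃̇ (partialIsȯ v0 v4 v5 ∧̇ mapṡ v0 v2 v1)) (A ∷ μ ∷ [])
          (λ u v → ∃[ h ] PartialIso h × Maps h u v) (λ _ _ _ → id , id) λ T (_ , T-def) →
        let
          unfold : ∀ {u v} → Maps T u v → ∃[ h ] PartialIso h × Maps h u v
          unfold m = proj₂ (proj₂ (proj₁ (T-def _ _) m))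

          fold : ∀ h → PartialIso h → ∀ u v → Maps h u v → Maps T u v
          fold h H u v m =
            proj₂ (T-def u v) (source∈μ H m , target H m , λ j → j h (H , m))
        in k T
          ( ( (λ u v m → (∈-stable _ _ λ no → unfold m λ h (H , m′) → no (source H m′))
                       , proj₁ (proj₂ (proj₁ (T-def _ _) m)))
            , (λ _ _ _ _ m m′ →
                  (λ lt → ∈-stable _ _ λ no → unfold m λ h (H , n) → unfold m′ λ h′ (H′ , n′) →
                     no (proj₁ (order₂ H H′ n n′) lt))
                , (λ lt → ∈-stable _ _ λ no → unfold m λ h (H , n) → unfold m′ λ h′ (H′ , n′) →
                     no (proj₂ (order₂ H H′ n n′) lt)))
            , (λ u v m u′ u′∈A u′∈u j → unfold m λ h (H , n) →
                 down H n u′∈A u′∈u λ v′ n′ → j v′ (fold h H _ _ n′))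
            , (λ u v m v′ v′∈v j → unfold m λ h (H , n) →
                 down′ H n v′∈v λ u′ n′ → j u′ (fold h H _ _ n′)))
          , fold)

      Total Onto : V → Set ℓ
      Total h = ∀ x → x ∈ A → ∃[ y ] Maps h x y
      Onto  h = ∀ y → y ∈ μ → ∃[ x ] Maps h x y

      -- The range is an initial segment, so it coincides with the first ordinal outside it.
      least-missed-value : ∀ {h} → PartialIso h → ¬ Onto h →
        ∃[ δ ] δ ∈ μ × (∀ v → v ∈ δ ↔ (∃[ u ] Maps h u v))
      least-missed-value {h} H ¬onto k = ¬onto λ y y∈μ y-missed →
        ∈-least (¬̇ (∃̇ mapṡ v2 v0 v1)) (h ∷ []) μ
          (λ j → j y (y∈μ , λ e → e y-missed)) λ δ (δ∈μ , missed , least) →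
        k δ (δ∈μ , λ v →
          (λ v∈δ no → least v (μ-transitive δ δ∈μ v v∈δ) v∈δ λ e → e no)
        , (λ hit → ∈-stable _ _ λ v∉δ → hit λ u m →
             trichotomy (target H m) δ∈μ v∉δ
               (λ { refl → missed λ j → j u m })
               (λ δ∈v → missed (down′ H m δ∈v))))

      -- Let `x` be the least point of `A` where the greatest `T` is undefined; its domain lies
      -- below `x`. If `T` misses a value, it extends to `x`, against maximality. If `T` is onto μ,
      -- it takes the value `x` at a point below `x`, against `no-ascent`.
      collapse : ∃[ T ] PartialIso T × Total T
      collapse k =
        greatest-partialIso λ T (iso , greatest) →
        k T (iso , λ a a∈A a-missed →
        ∈-least (¬̇ (∃̇ mapṡ v2 v1 v0)) (T ∷ []) A
          (λ j → j a (a∈A , λ e → e a-missed)) λ x (x∈A , undefined , least) →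
        let
          x∈μ = A⊆μ x x∈A

          domain : ∀ {u v} → Maps T u v → u ∈ x
          domain {u} m = ∈-stable _ _ λ u∉x →
            trichotomy (source∈μ iso m) x∈μ u∉x
              (λ { refl → undefined λ j → j _ m })
              (λ x∈u → undefined (down iso m x∈A x∈u))

          -- Otherwise T ∪ {(x , δ)} would be a larger partial isomorphism.
          onto : ¬ ¬ Onto T
          onto ¬onto =
            least-missed-value iso ¬onto λ δ (δ∈μ , range) →
            relation (mapṡ v3 v1 v0 ∨̇ ((v1 ≐ v4) ∧̇ (v0 ≐ v5))) (T ∷ x ∷ δ ∷ [])
              (λ u v → Maps T u v ∨ (u ≡ x × v ≡ δ)) (λ _ _ _ → id , id) λ T′ (_ , T′-def) →
            let (iso′ , m) = extend T iso x x∈A domain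
                  (λ u u∈A u∈x no → least u u∈A u∈x λ e → e no) δ δ∈μ range T′ T′-def in
            undefined λ j → j δ (greatest T′ iso′ x δ m)
        in
        onto λ surj → surj x x∈μ λ u m → no-ascent iso u (source∈μ iso m) x m (domain m))
        where
        -- The new pair goes on top: `T` is defined exactly on the part of `A` below `x`, and its
        -- range is `δ`.
        extend : ∀ T → PartialIso T → ∀ x → x ∈ A →
                 (∀ {u v} → Maps T u v → u ∈ x) →
                 (∀ u → u ∈ A → u ∈ x → ∃[ v ] Maps T u v) →
                 ∀ δ → δ ∈ μ → (∀ v → v ∈ δ ↔ (∃[ u ] Maps T u v)) →
                 ∀ T′ → (∀ u v → Maps T′ u v ↔ (u ∈ μ × v ∈ μ × (Maps T u v ∨ (u ≡ x × v ≡ δ)))) →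
                 PartialIso T′ × Maps T′ x δ
        extend T iso x x∈A domain total δ δ∈μ range T′ T′-def =
              ( (λ u v m → (∈-stable _ _ λ no → cases m (λ m′ → no (source iso m′))
                                                    (λ { refl refl → no x∈A }))
                         , proj₁ (proj₂ (proj₁ (T′-def u v) m)))
              , (λ _ _ _ _ m m′ → (λ lt → ∈-stable _ _ λ no → preserves m m′ λ e → no (proj₁ e lt))
                                , (λ lt → ∈-stable _ _ λ no → preserves m m′ λ e → no (proj₂ e lt)))
              , (λ u v m u′ u′∈A u′∈u j → cases m
                   (λ m′ → down iso m′ u′∈A u′∈u λ v′ n → j v′ (old n))
                   (λ { refl refl → total u′ u′∈A u′∈u λ v′ n → j v′ (old n) }))
              , (λ u v m v′ v′∈v j → cases m
                   (λ m′ → down′ iso m′ v′∈v λ u′ n → j u′ (old n))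
                   (λ { refl refl → proj₁ (range v′) v′∈v λ u′ n → j u′ (old n) })))
            , proj₂ (T′-def x δ) (A⊆μ x x∈A , δ∈μ , λ e → proj₂ e (refl , refl))
          where
          cases : ∀ {u v} → Maps T′ u v → (Maps T u v → ⊥) → (u ≡ x → v ≡ δ → ⊥) → ⊥
          cases m f g = proj₂ (proj₂ (proj₁ (T′-def _ _) m)) (f , λ (e , e′) → g e e′)

          old : ∀ {u v} → Maps T u v → Maps T′ u v
          old m = proj₂ (T′-def _ _) (source∈μ iso m , target iso m , λ e → proj₁ e m)

          value : ∀ {u v} → Maps T u v → v ∈ δ
          value m = proj₂ (range _) λ j → j _ m

          x∈μ = A⊆μ x x∈A

          preserves : ∀ {u v u′ v′} → Maps T′ u v → Maps T′ u′ v′ → ¬ ¬ (u ∈ u′ ↔ v ∈ v′)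
          preserves m m′ j = cases m
            (λ n → cases m′
              (λ n′ → j (order iso _ _ _ _ n n′))
              (λ { refl refl → j ((λ _ → value n) , (λ _ → domain n)) }))
            (λ { refl refl → cases m′
              (λ n′ → j ( (λ lt → ⊥-elim (asymmetric x∈μ (source∈μ iso n′) lt (domain n′)))
                        , (λ lt → ⊥-elim (asymmetric δ∈μ (target iso n′) lt (value n′)))))
              (λ { refl refl → j ( (λ lt → ⊥-elim (irreflexive x∈μ lt))
                                 , (λ lt → ⊥-elim (irreflexive δ∈μ lt))) }) })

      -- Serves twice in `large-contains`: with `δ` the whole range of `T`, to bound the size of
      -- `A`, and with `δ` the desired order type.
      restrict : ∀ {T} → PartialIso T → ∀ δ → (∀ v → v ∈ δ → ∃[ u ] Maps T u v) →
        ∃[ X ] ∃[ f ] (∀ x → x ∈ X ↔ (x ∈ A × (∃[ v ] Maps T x v × v ∈ δ)))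
                    × IsBijection f X δ × OrderPreserving f
      restrict {T} iso δ hit k =
        separation (∃̇ (mapṡ v2 v1 v0 ∧̇ (v0 ∈̇ v3))) (T ∷ δ ∷ []) A λ X X-def →
        relation (mapṡ v3 v1 v0 ∧̇ (v0 ∈̇ v4)) (T ∷ δ ∷ [])
          (λ u v → Maps T u v × v ∈ δ) (λ _ _ _ → id , id) λ f (rel , f-def) →
        let
          into : ∀ {u v} → Maps f u v → Maps T u v × v ∈ δ
          into m = proj₂ (proj₂ (proj₁ (f-def _ _) m))

          back : ∀ {u v} → Maps T u v → v ∈ δ → Maps f u v
          back m v∈δ = proj₂ (f-def _ _) (source∈μ iso m , target iso m , m , v∈δ)
        in
        k X λ j → j f
          ( X-def
          , ( ( (λ p p∈f l → rel p p∈f λ x e → e λ y pr →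
                   let (m , y∈δ) = into (λ i → i p (pr , p∈f)) in
                   l x λ i → i y (proj₂ (X-def x) (source iso m , λ i → i y (m , y∈δ)) , y∈δ , pr))
              , (λ x x∈X l → proj₂ (proj₁ (X-def x) x∈X) λ y (m , y∈δ) → l y (back m y∈δ))
              , (λ x y y′ m m′ → let n = proj₁ (into m) in
                   agree iso iso x (source∈μ iso n) y y′ n (proj₁ (into m′))))
            , (λ x x′ y m m′ → agree⁻¹ iso iso (proj₁ (into m)) (proj₁ (into m′)))
            , (λ y y∈δ l → hit y y∈δ λ x m → l x (back m y∈δ)))
          , (λ x x′ y y′ m m′ → order iso x x′ y y′ (proj₁ (into m)) (proj₁ (into m′))))

    -- Ultrafilters

    module _ (U : V) (uf : IsUltrafilterOn U μ) (np : ¬ IsPrincipalOn U μ)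
             (complete : IsCompleteOn μ U μ) where

      U⊆ : ∀ A → A ∈ U → A ⊆ μ
      U⊆ = proj₁ uf

      upward : ∀ A B → A ∈ U → A ⊆ B → B ⊆ μ → B ∈ U
      upward = proj₁ (proj₂ (proj₂ (proj₂ uf)))

      meet : ∀ A B → A ∈ U → B ∈ U → ∃[ z ] z ∈ A × z ∈ B
      meet A B A∈U B∈U disjoint =
        separation (v0 ∈̇ v1) (B ∷ []) A λ D D-def →
        proj₁ (proj₂ (proj₂ uf)) D (λ z z∈D → disjoint z (proj₁ (D-def z) z∈D))
          (proj₁ (proj₂ (proj₂ (proj₂ (proj₂ uf)))) A B D A∈U B∈U D-def)

      infix 0 ∀ᵁ-syntax

      -- Asking for some member of `U` inside `Φ`, not for the set of all such `z`, lets `Φ` be an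
      -- arbitrary predicate.
      ∀ᵁ-syntax : (V → Set ℓ) → Set ℓ
      ∀ᵁ-syntax Φ = ∃[ S ] S ∈ U × (∀ z → z ∈ S → Φ z)

      syntax ∀ᵁ-syntax (λ z → Φ) = ∀ᵁ[ z ] Φ

      dichotomy : ∀ {Φ Ψ : V → Set ℓ} →
        ∃[ S ] (∀ z → z ∈ S ↔ (z ∈ μ × Φ z)) →
        (∀ z → z ∈ μ → ¬ Φ z → Ψ z) →
        (∀ᵁ[ z ] Φ z) ∨ (∀ᵁ[ z ] Ψ z)
      dichotomy e Φ∨Ψ (¬Φ , ¬Ψ) =
        e λ S S-def →
        separation (¬̇ (v0 ∈̇ v1)) (S ∷ []) μ λ D D-def →
        proj₂ (proj₂ (proj₂ (proj₂ (proj₂ uf)))) S D (λ z z∈S → proj₁ (proj₁ (S-def z) z∈S)) D-def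
          ( (λ S∈U → ¬Φ λ k → k S (S∈U , λ z z∈S → proj₂ (proj₁ (S-def z) z∈S)))
          , (λ D∈U → ¬Ψ λ k → k D (D∈U , λ z z∈D →
               let (z∈μ , z∉S) = proj₁ (D-def z) z∈D in
               Φ∨Ψ z z∈μ λ φ → z∉S (proj₂ (S-def z) (z∈μ , φ)))))

      -- Otherwise some member of `U` contains at most `x`. Every member meets it, hence contains
      -- `x`, so `U` is principal at `x`.
      avoids : ∀ x → x ∈ μ → ∀ᵁ[ z ] ¬ z ≡ x
      avoids x x∈μ none =
        dichotomy (separation (v0 ≐ v1) (x ∷ []) μ) (λ _ _ → id) ((λ one → one λ S (S∈U , S⊆x) →
          np λ k → k x (x∈μ , λ A →
              (λ A∈U → U⊆ A A∈U , ∈-stable _ _ λ x∉A → meet A S A∈U S∈U λ z (z∈A , z∈S) →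
                 x∉A (subst (_∈ A) (S⊆x z z∈S) z∈A))
            , (λ (A⊆μ , x∈A) → upward S A S∈U
                 (λ z z∈S → subst (_∈ A) (sym (S⊆x z z∈S)) x∈A) A⊆μ)))
          , (λ e → e none))

      -- φ defines Φ; its variables besides z and x are those bound by the instance of
      -- replacement that produces the sequence ξ ↦ {z ∈ μ : Φ (h⁻¹ ξ) z}.
      ∀ᵁ-bounded : ∀ {h A δ} (φ : Formula (7 + n)) (ρ : Vec V n) (Φ : V → V → Set ℓ) →
        (∀ z S x ξ p → ⟦ φ ⟧ (z ∷ S ∷ x ∷ ξ ∷ p ∷ h ∷ μ ∷ ρ) ↔ Φ x z) →
        δ ∈ μ → IsBijection h A δ →
        (∀ x → x ∈ A → ∀ᵁ[ z ] Φ x z) →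
        ∀ᵁ[ z ] (∀ x → x ∈ A → Φ x z)
      ∀ᵁ-bounded {h = h} {A} {δ} φ ρ Φ φ⇔Φ δ∈μ (fun , inj , surj) many k =
        -- Here `p` is the pair of `ξ` and the whole section of `Φ` at the `x` that `h` sends to
        -- `ξ`. Picking a witness of `many` for each `x` would require choice; the section is
        -- definable.
        replacement (∃̇ (∃̇ (mapṡ v4 v1 v2 ∧̇′ paiṙ v3 v2 v0
            ∧̇′ (∀̇ ((v0 ∈̇ v1) ⇔̇ ((v0 ∈̇ v6) ∧̇ φ))))))
          (h ∷ μ ∷ ρ) δ
          (λ ξ p p′ ξ∈δ e e′ → ≡-stable λ p≢p′ →
             e λ x e₁ → e₁ λ S (m , pr , S-def) →
             e′ λ x′ e₁′ → e₁′ λ S′ (m′ , pr′ , S′-def) →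
             p≢p′ (pair-unique (subst (IsPair p ξ)
               (section-unique (inj x x′ ξ m m′) (section S-def) (section S′-def)) pr) pr′))
          λ f f-def →
        separation (∀̇ (∀̇ (mapṡ v3 v1 v0 ⇒̇ (v2 ∈̇ v0)))) (f ∷ []) μ λ D D-def →
        k D ( complete δ f D δ∈μ
                ( (λ p p∈f j → proj₁ (f-def p) p∈f λ ξ (ξ∈δ , e) →
                     e λ x e₁ → e₁ λ S (m , pr , S-def) →
                     j ξ λ l → l S (ξ∈δ , section∈U (maps-source fun m) (section S-def) , pr))
                , (λ ξ ξ∈δ j → surj ξ ξ∈δ λ x m →
                     -- Only the second `x` is meant; the others fill the slots of `S`, `ξ` and `p`,
                     -- where `φ⇔Φ` admits any set.
                     separation φ (x ∷ x ∷ x ∷ x ∷ h ∷ μ ∷ ρ) μ λ S S-def →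
                     pair-exists ξ S λ p pr →
                     j S λ l → l p (pr , proj₂ (f-def p) λ i → i ξ (ξ∈δ , λ i → i x λ i → i S
                       (m , pr , unsection (section S-def)))))
                , (λ ξ S S′ μS μS′ → ≡-stable λ S≢S′ →
                     entry f f-def μS λ x (m , S-def) → entry f f-def μS′ λ x′ (m′ , S′-def) →
                     S≢S′ (section-unique (inj x x′ ξ m m′) S-def S′-def)))
                D-def
            , λ z z∈D x x∈A → Φ-stable λ ¬Φ →
                proj₁ (proj₂ fun) x x∈A λ ξ m →
                separation φ (x ∷ x ∷ x ∷ x ∷ h ∷ μ ∷ ρ) μ λ S S-def →
                ¬Φ (proj₂ (proj₁ (section S-def z) (proj₂ (proj₁ (D-def z) z∈D) ξ S λ l →
                  pair-exists ξ S λ p pr → l p (pr , proj₂ (f-def p) λ i →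
                    i ξ (maps-target fun m , λ i → i x λ i → i S
                      (m , pr , unsection (section S-def))))))))
        where
        Section : V → V → Set ℓ
        Section x S = ∀ z → z ∈ S ↔ (z ∈ μ × Φ x z)

        Def : V → Set ℓ
        Def f = ∀ p → p ∈ f ↔ (∃[ ξ ] ξ ∈ δ × (∃[ x ] ∃[ S ] Maps h x ξ × IsPair p ξ S
          × (∀ z → z ∈ S ↔ (z ∈ μ × ⟦ φ ⟧ (z ∷ S ∷ x ∷ ξ ∷ p ∷ h ∷ μ ∷ ρ)))))

        Φ-stable : ∀ {x z} → Stable (Φ x z)
        Φ-stable {x} {z} ¬¬Φ = proj₁ (φ⇔Φ z z x z z) (⟦⟧-stable φ _ λ no →
          ¬¬Φ λ Φxz → no (proj₂ (φ⇔Φ z z x z z) Φxz))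

        section : ∀ {S R x ξ p} →
          (∀ z → z ∈ S ↔ (z ∈ μ × ⟦ φ ⟧ (z ∷ R ∷ x ∷ ξ ∷ p ∷ h ∷ μ ∷ ρ))) → Section x S
        section S-def z =
            (λ z∈S → let (z∈μ , φz) = proj₁ (S-def z) z∈S in z∈μ , proj₁ (φ⇔Φ _ _ _ _ _) φz)
          , (λ (z∈μ , Φz) → proj₂ (S-def z) (z∈μ , proj₂ (φ⇔Φ _ _ _ _ _) Φz))

        unsection : ∀ {S R x ξ p} → Section x S →
          (∀ z → z ∈ S ↔ (z ∈ μ × ⟦ φ ⟧ (z ∷ R ∷ x ∷ ξ ∷ p ∷ h ∷ μ ∷ ρ)))
        unsection S-def z =
            (λ z∈S → let (z∈μ , Φz) = proj₁ (S-def z) z∈S in z∈μ , proj₂ (φ⇔Φ _ _ _ _ _) Φz)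
          , (λ (z∈μ , φz) → proj₂ (S-def z) (z∈μ , proj₁ (φ⇔Φ _ _ _ _ _) φz))

        section-unique : ∀ {x x′ S S′} → x ≡ x′ → Section x S → Section x′ S′ → S ≡ S′
        section-unique refl D D′ = extensionality _ _ λ z →
          (λ z∈ → proj₂ (D′ z) (proj₁ (D z) z∈)) , (λ z∈ → proj₂ (D z) (proj₁ (D′ z) z∈))

        section∈U : ∀ {x S} → x ∈ A → Section x S → S ∈ U
        section∈U x∈A S-def = ∈-stable _ _ λ S∉U → many _ x∈A λ R (R∈U , R⊆) →
          S∉U (upward R _ R∈U (λ z z∈R → proj₂ (S-def z) (U⊆ R R∈U z z∈R , R⊆ z z∈R))
            (λ z z∈S → proj₁ (proj₁ (S-def z) z∈S)))

        entry : ∀ f → Def f → ∀ {ξ S} → Maps f ξ S → ∃[ x ] Maps h x ξ × Section x S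
        entry f f-def mf j = mf λ p (pr , p∈f) →
          proj₁ (f-def p) p∈f λ ξ′ (_ , e) → e λ x e₁ → e₁ λ S′ (m , pr′ , S′-def) →
          j x ( subst (Maps h x) (pair-injective₁ pr′ pr) m
              , subst (Section x) (pair-injective₂ pr′ pr) (section S′-def))

      -- By completeness U-many `z` avoid all points of `A` at once, yet two members of `U` must
      -- meet.
      small-null : ∀ {h A δ} → A ⊆ μ → δ ∈ μ → IsBijection h A δ → ¬ A ∈ U
      small-null {A = A} A⊆μ δ∈μ bij A∈U =
        ∀ᵁ-bounded (¬̇ (v0 ≐ v2)) [] (λ x z → ¬ z ≡ x) (λ _ _ _ _ _ → id , id) δ∈μ bij
          (λ x x∈A → avoids x (A⊆μ x x∈A)) λ S (S∈U , avoid) →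
        meet S A S∈U A∈U λ z (z∈S , z∈A) → avoid z z∈S z z∈A refl

      large-contains : ∀ A δ → A ∈ U → Ordinal δ → δ ⊆ μ → ∃[ X ] X ⊆ A × HasOrderType X δ
      large-contains A δ A∈U δ-ord δ⊆μ k =
        collapse A A⊆μ λ T (iso , total) →
        let
          onto : ¬ ¬ Onto A A⊆μ T
          onto ¬onto =
            least-missed-value A A⊆μ iso ¬onto λ β (β∈μ , range) →
            restrict A A⊆μ iso β (λ v → proj₁ (range v)) λ X e → e λ f (X-def , bij , _) →
            small-null (λ x x∈X → A⊆μ x (proj₁ (proj₁ (X-def x) x∈X))) β∈μ bij
              -- The range of `T` is `β`, so the preimage `X` of `β` is all of `A`.
              (upward A X A∈U
                (λ x x∈A → proj₂ (X-def x) (x∈A , λ no → total x x∈A λ y m →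
                  no y (m , proj₂ (range y) λ j → j x m)))
                (λ x x∈X → A⊆μ x (proj₁ (proj₁ (X-def x) x∈X))))
        in
        onto λ surj →
        restrict A A⊆μ iso δ (λ v v∈δ → surj v (δ⊆μ v v∈δ)) λ X e → e λ f (X-def , bij , ordered) →
        k X ( (λ x x∈X → proj₁ (proj₁ (X-def x) x∈X))
            , δ-ord , λ j → j f (bij , ordered))
        where
        A⊆μ : A ⊆ μ
        A⊆μ = U⊆ A A∈U

      -- `A` and `B` serve as index sets for completeness, so their type is some κ below μ. `C` is
      -- picked last, so its type `ζ` may be μ itself.
      monochromatic : ∀ c κ ζ 𝟐 → IsTwo 𝟐 → Ordinal κ → κ ∈ μ → Ordinal ζ → ζ ⊆ μ →
        (∀ x y z → x ∈ μ → y ∈ μ → z ∈ μ → ∃[ i ] i ∈ 𝟐 × MapsTriple c x y z i) →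
        ∃[ A ] ∃[ B ] ∃[ C ]
            A ⊆ μ × B ⊆ μ × C ⊆ μ
          × HasOrderType A κ × HasOrderType B κ × HasOrderType C ζ
          × ConstantOn c A B C 𝟐
      monochromatic c κ ζ 𝟐 two κ-ord κ∈μ ζ-ord ζ⊆μ colour k =
        two λ o t → t λ l (_ , _ , two-def) →
        let
          finish : ∀ i → i ∈ 𝟐 → ¬ (∀ᵁ[ x ] ∀ᵁ[ y ] ∀ᵁ[ z ] MapsTriple c x y z i)
          finish i i∈𝟐 many =
            many λ S (S∈U , S-large) →
            large-contains S κ S∈U κ-ord κ⊆μ λ A (A⊆S , A-type) →
            proj₂ A-type λ f (f-bij , _) →
            ∀ᵁ-bounded (∃̇ ((v0 ∈̇ v8) ∧̇ (∀̇ ((v0 ∈̇ v1) ⇒̇ mapsTriplė v10 v4 v2 v0 v11))))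
              (U ∷ c ∷ i ∷ []) (λ x y → ∀ᵁ[ z ] MapsTriple c x y z i) (λ _ _ _ _ _ → id , id)
              κ∈μ f-bij (λ x x∈A → S-large x (A⊆S x x∈A)) λ R (R∈U , R-large) →
            large-contains R κ R∈U κ-ord κ⊆μ λ B (B⊆R , B-type) →
            proj₂ B-type λ g (g-bij , _) →
            -- Completeness twice: over `B` for each fixed `x`, and then over `A`.
            ∀ᵁ-bounded (∀̇ ((v0 ∈̇ v8) ⇒̇ mapsTriplė v9 v3 v0 v1 v10))
              (B ∷ c ∷ i ∷ []) (λ x z → ∀ y → y ∈ B → MapsTriple c x y z i)
              (λ _ _ _ _ _ → id , id) κ∈μ f-bij
              (λ x x∈A → ∀ᵁ-bounded (mapsTriplė v7 v8 v2 v0 v9) (c ∷ x ∷ i ∷ [])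
                (λ y z → MapsTriple c x y z i) (λ _ _ _ _ _ → id , id) κ∈μ g-bij
                (λ y y∈B → R-large y (B⊆R y y∈B) x x∈A)) λ Q (Q∈U , Q-mono) →
            large-contains Q ζ Q∈U ζ-ord ζ⊆μ λ C (C⊆Q , C-type) →
            k A λ k → k B λ k → k C
              ( (λ x x∈A → U⊆ S S∈U x (A⊆S x x∈A))
              , (λ x x∈B → U⊆ R R∈U x (B⊆R x x∈B))
              , (λ x x∈C → U⊆ Q Q∈U x (C⊆Q x x∈C))
              , A-type , B-type , C-type
              , λ j → j i (i∈𝟐 , λ x y z x∈A y∈B z∈C → Q-mono z (C⊆Q z z∈C) x x∈A y y∈B))
        in
        -- The split into two colours is carried outwards from `z` to `x`: a quantifier that fails
        -- for `o` holds for `l`. Each goal for `l` is a negation, whose argument is named `¬El`,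
        -- `¬Dl` or `¬cl`.
        dichotomy
          (separation (∃̇ ((v0 ∈̇ v2) ∧̇ (∀̇ ((v0 ∈̇ v1) ⇒̇ (∃̇ ((v0 ∈̇ v4)
            ∧̇ (∀̇ ((v0 ∈̇ v1) ⇒̇ mapsTriplė v6 v4 v2 v0 v7))))))))
            (U ∷ c ∷ o ∷ []) μ)
          (λ x x∈μ ¬Eo ¬El → dichotomy
            (separation (∃̇ ((v0 ∈̇ v2) ∧̇ (∀̇ ((v0 ∈̇ v1) ⇒̇ mapsTriplė v4 v5 v2 v0 v6))))
              (U ∷ c ∷ x ∷ o ∷ []) μ)
            (λ y y∈μ ¬Do ¬Dl → dichotomy
              (separation (mapsTriplė v1 v2 v3 v0 v4) (c ∷ x ∷ y ∷ o ∷ []) μ)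
              (λ z z∈μ ¬co ¬cl → colour x y z x∈μ y∈μ z∈μ λ i (i∈𝟐 , ci) →
                 proj₁ (two-def i) i∈𝟐
                   ((λ { refl → ci λ q e → ¬co λ k → k q e }) , (λ { refl → ci ¬cl })))
              ((λ e → e λ S s → ¬Do λ k → k S s) , (λ e → e ¬Dl)))
            ((λ e → e λ S s → ¬Eo λ k → k S s) , (λ e → e ¬El)))
          (finish o (left∈ two-def) , finish l (right∈ two-def))
        where
        κ⊆μ : κ ⊆ μ
        κ⊆μ = μ-transitive κ κ∈μ

  -- From colourings to the cube relations.

  coloring-value : ∀ {c P Q μ θ} → IsProduct P μ μ → IsProduct Q P μ → IsFunction c Q θ →
    ∀ x y z → x ∈ μ → y ∈ μ → z ∈ μ → ∃[ i ] i ∈ θ × MapsTriple c x y z i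
  coloring-value P-def Q-def fun x y z x∈μ y∈μ z∈μ k =
    pair-exists x y λ q xy →
    pair-exists q z λ t qz →
    proj₁ (proj₂ fun) t (proj₂ (Q-def t) λ j → j q λ j → j z
      ((proj₂ (P-def q) λ j → j x λ j → j y (x∈μ , y∈μ , xy)) , z∈μ , qz)) λ i m →
    k i (maps-target fun m , λ j → j q λ j → j t (xy , qz , m))

  measurable-cube : ∀ {κ μ ζ 𝟐} → Ordinal κ → Ordinal μ → κ ∈ μ → Measurable μ → IsTwo 𝟐 →
    Ordinal ζ → ζ ⊆ μ → Cube μ μ μ κ κ ζ 𝟐
  measurable-cube κ-ord μ-ord κ∈μ measurable two ζ-ord ζ⊆μ c coloring k =
    measurable λ U (uf , np , complete) →
    coloring λ P e → e λ Q (P-def , Q-def , fun) →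
    monochromatic _ P μ-ord P-def U uf np complete c _ _ _ two κ-ord κ∈μ ζ-ord ζ⊆μ
      (coloring-value P-def Q-def fun) k

theorem4p3 : {ℓ : Level} (M : ZF ℓ) → let open ZF M in
    (κ κ⁺ 𝟐 : V) →
    InfiniteCardinal κ → IsSuccessorCardinal κ⁺ κ → Measurable κ⁺ → IsTwo 𝟐 →
    Cube κ⁺ κ⁺ κ⁺ κ κ κ 𝟐 × Cube κ⁺ κ⁺ κ⁺ κ κ κ⁺ 𝟐
theorem4p3 M κ κ⁺ 𝟐 ((κ-ord , _) , _) ((κ⁺-ord , _) , κ∈κ⁺ , _) measurable two =
    cube κ-ord (proj₁ κ⁺-ord κ κ∈κ⁺)
  , cube κ⁺-ord (λ _ → id)
  where
  open SetTheory M
  cube = λ {ζ} → measurable-cube {ζ = ζ} κ-ord κ⁺-ord κ∈κ⁺ measurable two
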